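{- Let $\mathbb{T}$ be a geometric theory. Let $\sigma$ be a geometric sequent over the signature of $\mathbb{T}$. Then the following statements are equivalent. (1) There is a $\mathbb{T}$-derivation of $\sigma$ in geometric logic. (2) There is a $\mathbb{T}$-derivation of $\sigma$ in infinitary intuitionistic first-order logic. (3) There is a $\mathbb{T}$-derivation of $\sigma$ in infinitary classical first-order logic.
   Context: The metatheory is constructive (no law of excluded middle, no axiom of choice) but impredicative. A signature consists of a set of sorts, a set of function symbols $f : X_1\times\cdots\times X_n\to Y$ (with $n\ge 0$) and a set of relation symbols $R \hookrightarrow X_1\times\cdots\times X_n$ (with $n\ge 0$). Sorts are not assumed to be inhabited, so sequents carry an explicit context. Infinitary first-order formulas in a context (a finite list of sorted variables) are built from atomic formulas (equalities and relation symbols applied to terms) using $\top,\wedge,\bigwedge,\bot,\vee,\bigvee,\Rightarrow,\forall,\exists$, where $\bigwedge$ and $\bigvee$ range over arbitrary set-indexed families of formulas. $\neg\varphi$ abbreviates $\varphi\Rightarrow\bot$. A geometric formula is one built using only $=,\top,\wedge,\bot,\vee,\bigvee,\exists$ and the relation symbols. A geometric sequent in a context $\vec x$ is an expression $\varphi \vdash_{\vec x}\psi$ with $\varphi,\psi$ geometric formulas in the context $\vec x$. A geometric theory consists of a signature and a set of geometric sequents over it (its axioms). A $\mathbb{T}$-derivation is a derivation in the class inductively generated by the axioms of $\mathbb{T}$ and the rules of the respective logic. (For rules with set-indexed families of premises, one allows for each index an inhabited set of subderivations rather than a chosen one.) Rules of geometric logic: - Structural: $\varphi\vdash_{\vec x}\varphi$;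 from $\varphi\vdash_{\vec x}\psi$ and $\psi\vdash_{\vec x}\chi$ infer $\varphi\vdash_{\vec x}\chi$; from $\varphi\vdash_{\vec x}\psi$ infer $\varphi[\vec s/\vec x]\vdash_{\vec y}\psi[\vec s/\vec x]$ ($\vec s$ terms in context $\vec y$, with the $\vec y$ not bound). - Conjunction: $\varphi\vdash_{\vec x}\top$; $\varphi\wedge\psi\vdash_{\vec x}\varphi$; $\varphi\wedge\psi\vdash_{\vec x}\psi$; from $\varphi\vdash_{\vec x}\psi$ and $\varphi\vdash_{\vec x}\chi$ infer $\varphi\vdash_{\vec x}\psi\wedge\chi$. - Finitary disjunction: $\bot\vdash_{\vec x}\varphi$; $\varphi\vdash_{\vec x}\varphi\vee\psi$; $\psi\vdash_{\vec x}\varphi\vee\psi$; from $\varphi\vdash_{\vec x}\chi$ and $\psi\vdash_{\vec x}\chi$ infer $\varphi\vee\psi\vdash_{\vec x}\chi$. - Infinitary disjunction: $\varphi_{i_0}\vdash_{\vec x}\bigvee_{i\in I}\varphi_i$; from $\varphi_i\vdash_{\vec x}\chi$ for each $i\in I$ infer $\bigvee_{i\in I}\varphi_i\vdash_{\vec x}\chi$. - Existential quantification (both directions): $\varphi\vdash_{\vec x,y}\psi$ if and only if $\exists y{:}Y.\,\varphi\vdash_{\vec x}\psi$ ($y$ not free in $\psi$). - Mixed rules: $(\bigvee_i\varphi_i)\wedge\psi\vdash_{\vec x}\bigvee_i(\varphi_i\wedge\psi)$; $(\exists y{:}Y.\,\varphi)\wedge\psi\vdash_{\vec x}\exists y{:}Y.\,(\varphi\wedge\psi)$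 ($y$ none of the $\vec x$). - Equality: $\top\vdash_x x=x$; $(\vec x=\vec y)\wedge\varphi\vdash_{\vec z}\varphi[\vec y/\vec x]$, where $\vec x=\vec y$ abbreviates $x_1=y_1\wedge\cdots\wedge x_n=y_n$. Rules of infinitary intuitionistic first-order logic: all the rules of geometric logic (the structural rules, the rules for conjunction, finitary disjunction, infinitary disjunction and existential quantification, the mixed rules and the rules for equality), now for all infinitary first-order formulas $\varphi,\psi,\chi,\varphi_i$ instead of only geometric ones, and in addition: - Infinitary conjunction: $\bigwedge_{i\in I}\varphi_i\vdash_{\vec x}\varphi_{i_0}$; from $\psi\vdash_{\vec x}\varphi_i$ for each $i\in I$ infer $\psi\vdash_{\vec x}\bigwedge_{i\in I}\varphi_i$. - Implication (both directions): $\varphi\wedge\psi\vdash_{\vec x}\chi$ if and only if $\varphi\vdash_{\vec x}\psi\Rightarrow\chi$. - Universal quantification (both directions): $\varphi\vdash_{\vec x,y}\psi$ if and only if $\varphi\vdash_{\vec x}\forall y{:}Y.\,\psi$ ($y$ not free in $\varphi$). Infinitary classical first-order logic is infinitary intuitionistic first-order logic extended by the law of excluded middle $\top\vdash_{\vec x}\varphi\vee\neg\varphi$ for all infinitary first-order formulas $\varphi$. -}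

module Defs where

open import Data.List.Base using (List; []; _∷_)
open import Data.List.Membership.Propositional using (_∈_)
import Data.List.Relation.Binary.Sublist.Propositional as Sublist
open import Data.List.Relation.Unary.All as All using (All; []; _∷_)
open import Data.List.Relation.Unary.Any using (here; there)
import Data.Unit.Polymorphic.Base as Unit
open import Level using (Level; suc)
open import Relation.Binary.PropositionalEquality.Core using (_≡_; refl)

record Signature (ℓ : Level) : Set (suc ℓ) where
  field
    Sort  : Set ℓ
    Fun   : Set ℓ
    dom   : Fun → List Sort
    cod   : Fun → Sort
    Rel   : Set ℓ
    arity : Rel → List Sort

data Logic : Set where
  geometric intuitionistic classical : Logic

data FirstOrder : Logic → Set where
  intuitionistic : FirstOrder intuitionistic
  classical      : FirstOrder classical

module Syntax {ℓ : Level} (S : Signature ℓ) where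

  open Signature S
  open Sublist {A = Sort} using ([]; _∷_; _∷ʳ_)
  open Sublist {A = Sort} public using (_⊆_)

  -- Variables are de Bruijn: a variable of sort X in context Γ is an element
  -- of X ∈ Γ, and binding a variable of sort Y turns Γ into Y ∷ Γ.
  Ctx : Set ℓ
  Ctx = List Sort

  data Term (Γ : Ctx) : Sort → Set ℓ where
    var : ∀ {X} → X ∈ Γ → Term Γ X
    app : (f : Fun) → All (Term Γ) (dom f) → Term Γ (cod f)

  infix  8 _≐_
  infixr 7 _∧_
  infixr 6 _∨_
  infixr 5 _⇒_

  data Formula (Γ : Ctx) : Set (suc ℓ) where
    _≐_   : ∀ {X} → Term Γ X → Term Γ X → Formula Γ
    rel   : (R : Rel) → All (Term Γ) (arity R) → Formula Γ
    ⊤ ⊥   : Formula Γ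
    _∧_   : Formula Γ → Formula Γ → Formula Γ
    _∨_   : Formula Γ → Formula Γ → Formula Γ
    _⇒_   : Formula Γ → Formula Γ → Formula Γ
    ⋀ ⋁   : {I : Set ℓ} → (I → Formula Γ) → Formula Γ
    all ex : (Y : Sort) → Formula (Y ∷ Γ) → Formula Γ

  ¬_ : ∀ {Γ} → Formula Γ → Formula Γ
  ¬ φ = φ ⇒ ⊥

  data IsGeometric {Γ : Ctx} : Formula Γ → Set (suc ℓ) where
    _≐_ : ∀ {X} (s t : Term Γ X) → IsGeometric (s ≐ t)
    rel : ∀ R (ts : All (Term Γ) (arity R)) → IsGeometric (rel R ts)
    ⊤   : IsGeometric ⊤
    ⊥   : IsGeometric ⊥
    _∧_ : ∀ {φ ψ} → IsGeometric φ → IsGeometric ψ → IsGeometric (φ ∧ ψ)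
    _∨_ : ∀ {φ ψ} → IsGeometric φ → IsGeometric ψ → IsGeometric (φ ∨ ψ)
    ⋁   : ∀ {I : Set ℓ} {φ : I → Formula Γ} → (∀ i → IsGeometric (φ i)) → IsGeometric (⋁ φ)
    ex  : ∀ {Y φ} → IsGeometric {Y ∷ Γ} φ → IsGeometric (ex Y φ)

  -- A substitution for the variables Γ by terms in context Δ.
  Sub : Ctx → Ctx → Set ℓ
  Sub Δ Γ = All (Term Δ) Γ

  vars : ∀ {Γ Xs} → All (_∈ Γ) Xs → Sub Γ Xs
  vars = All.map var

  idˢ : ∀ {Γ} → Sub Γ Γ
  idˢ = All.tabulate var

  wkˢ : ∀ {Γ Y} → Sub (Y ∷ Γ) Γ
  wkˢ = All.tabulate λ x → var (there x)

  mutual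
    _[_]ᵗ : ∀ {Γ Δ X} → Term Γ X → Sub Δ Γ → Term Δ X
    var x    [ σ ]ᵗ = All.lookup σ x
    app f ts [ σ ]ᵗ = app f (ts [ σ ]ˢ)

    _[_]ˢ : ∀ {Γ Δ Xs} → Sub Γ Xs → Sub Δ Γ → Sub Δ Xs
    []       [ σ ]ˢ = []
    (t ∷ ts) [ σ ]ˢ = t [ σ ]ᵗ ∷ ts [ σ ]ˢ

  liftˢ : ∀ {Γ Δ} Y → Sub Δ Γ → Sub (Y ∷ Δ) (Y ∷ Γ)
  liftˢ Y σ = var (here refl) ∷ σ [ wkˢ ]ˢ

  infixl 9 _[_]

  _[_] : ∀ {Γ Δ} → Formula Γ → Sub Δ Γ → Formula Δ
  (s ≐ t)  [ σ ] = s [ σ ]ᵗ ≐ t [ σ ]ᵗ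
  rel R ts [ σ ] = rel R (ts [ σ ]ˢ)
  ⊤        [ σ ] = ⊤
  ⊥        [ σ ] = ⊥
  (φ ∧ ψ)  [ σ ] = φ [ σ ] ∧ ψ [ σ ]
  (φ ∨ ψ)  [ σ ] = φ [ σ ] ∨ ψ [ σ ]
  (φ ⇒ ψ)  [ σ ] = φ [ σ ] ⇒ ψ [ σ ]
  ⋀ φ      [ σ ] = ⋀ λ i → φ i [ σ ]
  ⋁ φ      [ σ ] = ⋁ λ i → φ i [ σ ]
  all Y φ  [ σ ] = all Y (φ [ liftˢ Y σ ])
  ex Y φ   [ σ ] = ex Y (φ [ liftˢ Y σ ])

  weaken : ∀ {Γ Y} → Formula Γ → Formula (Y ∷ Γ)
  weaken φ = φ [ wkˢ ]

  infix 8 _≐*_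

  _≐*_ : ∀ {Γ Xs} → Sub Γ Xs → Sub Γ Xs → Formula Γ
  []       ≐* []       = ⊤
  (s ∷ ss) ≐* (t ∷ ts) = s ≐ t ∧ ss ≐* ts

  -- A list of distinct variables of Γ, with sorts Xs, is given by a proof of
  -- Xs ⊆ Γ.  It is listed in the order of Γ; as only simultaneous substitution
  -- and conjunctions of equations are formed from it, this loses nothing.
  chosen : ∀ {Γ Xs} → Xs ⊆ Γ → All (_∈ Γ) Xs
  chosen xs = All.tabulate (Sublist.lookup xs)

  -- replace xs ts σ agrees with σ except that it sends the variables xs to ts.
  replace : ∀ {Γ Δ Xs} → Xs ⊆ Γ → Sub Δ Xs → Sub Δ Γ → Sub Δ Γ
  replace []          []       []      = []
  replace (_ ∷ʳ xs)   ts       (s ∷ σ) = s ∷ replace xs ts σ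
  replace (refl ∷ xs) (t ∷ ts) (_ ∷ σ) = t ∷ replace xs ts σ

  infix 4 _⊢_

  record Sequent : Set (suc ℓ) where
    constructor _⊢_
    field
      {context}  : Ctx
      antecedent : Formula context
      succedent  : Formula context

  record IsGeometricSequent (σ : Sequent) : Set (suc ℓ) where
    constructor _⊢_
    open Sequent σ
    field
      antecedent-geometric : IsGeometric antecedent
      succedent-geometric  : IsGeometric succedent

  InLanguage : ∀ {Γ} → Logic → Formula Γ → Set (suc ℓ)
  InLanguage geometric      φ = IsGeometric φ
  InLanguage intuitionistic φ = Unit.⊤
  InLanguage classical      φ = Unit.⊤

record GeometricTheory (ℓ : Level) : Set (suc ℓ) where
  field
    signature : Signature ℓ
  open Syntax signature public
  field
    Axiom           : Set ℓ
    axiom           : Axiom → Sequent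
    axiom-geometric : ∀ a → IsGeometricSequent (axiom a)

module Deduction {ℓ : Level} (T : GeometricTheory ℓ) where

  open GeometricTheory T

  -- The InLanguage premises, one for each formula that the other premises do
  -- not already constrain, ensure that derivations in geometric logic involve
  -- geometric formulas only.
  data Derivation (L : Logic) : Sequent → Set (suc ℓ) where

    ax : (a : Axiom) → Derivation L (axiom a)

    identity : ∀ {Γ} {φ : Formula Γ} → InLanguage L φ → Derivation L (φ ⊢ φ)
    cut : ∀ {Γ} {φ ψ χ : Formula Γ} →
      Derivation L (φ ⊢ ψ) → Derivation L (ψ ⊢ χ) → Derivation L (φ ⊢ χ)
    substitution : ∀ {Γ Δ} {φ ψ : Formula Γ} (s : Sub Δ Γ) →
      Derivation L (φ ⊢ ψ) → Derivation L (φ [ s ] ⊢ ψ [ s ])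

    ⊤-intro : ∀ {Γ} {φ : Formula Γ} → InLanguage L φ → Derivation L (φ ⊢ ⊤)
    ∧-elim₁ : ∀ {Γ} {φ ψ : Formula Γ} →
      InLanguage L φ → InLanguage L ψ → Derivation L (φ ∧ ψ ⊢ φ)
    ∧-elim₂ : ∀ {Γ} {φ ψ : Formula Γ} →
      InLanguage L φ → InLanguage L ψ → Derivation L (φ ∧ ψ ⊢ ψ)
    ∧-intro : ∀ {Γ} {φ ψ χ : Formula Γ} →
      Derivation L (φ ⊢ ψ) → Derivation L (φ ⊢ χ) → Derivation L (φ ⊢ ψ ∧ χ)

    ⊥-elim : ∀ {Γ} {φ : Formula Γ} → InLanguage L φ → Derivation L (⊥ ⊢ φ)
    ∨-intro₁ : ∀ {Γ} {φ ψ : Formula Γ} →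
      InLanguage L φ → InLanguage L ψ → Derivation L (φ ⊢ φ ∨ ψ)
    ∨-intro₂ : ∀ {Γ} {φ ψ : Formula Γ} →
      InLanguage L φ → InLanguage L ψ → Derivation L (ψ ⊢ φ ∨ ψ)
    ∨-elim : ∀ {Γ} {φ ψ χ : Formula Γ} →
      Derivation L (φ ⊢ χ) → Derivation L (ψ ⊢ χ) → Derivation L (φ ∨ ψ ⊢ χ)

    ⋁-intro : ∀ {Γ} {I : Set ℓ} {φ : I → Formula Γ} →
      (∀ i → InLanguage L (φ i)) → (i₀ : I) → Derivation L (φ i₀ ⊢ ⋁ φ)
    ⋁-elim : ∀ {Γ} {I : Set ℓ} {φ : I → Formula Γ} {χ : Formula Γ} → InLanguage L χ →
      (∀ i → Derivation L (φ i ⊢ χ)) → Derivation L (⋁ φ ⊢ χ)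

    ∃-elim : ∀ {Γ Y} {φ : Formula (Y ∷ Γ)} {ψ : Formula Γ} →
      Derivation L (φ ⊢ weaken ψ) → Derivation L (ex Y φ ⊢ ψ)
    ∃-elim⁻¹ : ∀ {Γ Y} {φ : Formula (Y ∷ Γ)} {ψ : Formula Γ} →
      Derivation L (ex Y φ ⊢ ψ) → Derivation L (φ ⊢ weaken ψ)

    ⋁-∧-distrib : ∀ {Γ} {I : Set ℓ} {φ : I → Formula Γ} {ψ : Formula Γ} →
      (∀ i → InLanguage L (φ i)) → InLanguage L ψ →
      Derivation L (⋁ φ ∧ ψ ⊢ ⋁ λ i → φ i ∧ ψ)
    ∃-∧-distrib : ∀ {Γ Y} {φ : Formula (Y ∷ Γ)} {ψ : Formula Γ} →
      InLanguage L φ → InLanguage L ψ →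
      Derivation L (ex Y φ ∧ ψ ⊢ ex Y (φ ∧ weaken ψ))

    ≐-refl : ∀ {X} → let x = var (here refl) in
      Derivation L (_⊢_ {X ∷ []} ⊤ (x ≐ x))
    ≐-subst : ∀ {Γ Xs} {φ : Formula Γ} (xs : Xs ⊆ Γ) (ys : All (_∈ Γ) Xs) → InLanguage L φ →
      Derivation L (vars (chosen xs) ≐* vars ys ∧ φ ⊢ φ [ replace xs (vars ys) idˢ ])

    ⋀-elim : FirstOrder L → ∀ {Γ} {I : Set ℓ} {φ : I → Formula Γ} (i₀ : I) →
      Derivation L (⋀ φ ⊢ φ i₀)
    ⋀-intro : FirstOrder L → ∀ {Γ} {I : Set ℓ} {φ : I → Formula Γ} {ψ : Formula Γ} →
      (∀ i → Derivation L (ψ ⊢ φ i)) → Derivation L (ψ ⊢ ⋀ φ)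

    ⇒-intro : FirstOrder L → ∀ {Γ} {φ ψ χ : Formula Γ} →
      Derivation L (φ ∧ ψ ⊢ χ) → Derivation L (φ ⊢ ψ ⇒ χ)
    ⇒-intro⁻¹ : FirstOrder L → ∀ {Γ} {φ ψ χ : Formula Γ} →
      Derivation L (φ ⊢ ψ ⇒ χ) → Derivation L (φ ∧ ψ ⊢ χ)

    ∀-intro : FirstOrder L → ∀ {Γ Y} {φ : Formula Γ} {ψ : Formula (Y ∷ Γ)} →
      Derivation L (weaken φ ⊢ ψ) → Derivation L (φ ⊢ all Y ψ)
    ∀-intro⁻¹ : FirstOrder L → ∀ {Γ Y} {φ : Formula Γ} {ψ : Formula (Y ∷ Γ)} →
      Derivation L (φ ⊢ all Y ψ) → Derivation L (weaken φ ⊢ ψ)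

    excluded-middle : L ≡ classical → ∀ {Γ} {φ : Formula Γ} → Derivation L (⊤ ⊢ φ ∨ ¬ φ)

{-# OPTIONS --safe #-}

-- Only the passage from classical to geometric logic needs an idea.  Consider the Kripke
-- model whose worlds consist of a context, a geometric assumption α and a geometric goal χ
-- in it, together with an assignment of terms to the variables.  A world is reached from
-- another one by substituting terms, strengthening α and weakening χ.  As in Friedman's
-- A-translation, falsity at a world is read not as absurdity but as geometric provability
-- of α ⊢ χ.  Formulas are interpreted by predicates stable under double negation relative
-- to this falsity, so classical logic is sound.  A geometric formula φ is interpreted as the
-- double negation of "α proves φ": for disjunctions and existential quantifiers, pass to the
-- worlds where α is strengthened by a disjunct or by a generic witness, and collect the
-- resulting proofs of χ.  Hence the axioms hold, and evaluating a classically derivable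
-- φ ⊢ ψ at the world with assumption φ and goal ψ yields a geometric derivation.
module Submission where

open import Defs
open import Level using (Level; Lift; lift; suc)
open import Data.Bool.Base using (Bool; true; false; if_then_else_)
open import Data.List.Base using ([]; _∷_; _++_)
open import Data.List.Membership.Propositional using (_∈_)
open import Data.List.Membership.Propositional.Properties using (∈-++⁺ʳ)
import Data.List.Relation.Binary.Sublist.Propositional as Sublist
open import Data.List.Relation.Unary.All as All using (All; []; _∷_; lookup; tabulate)
import Data.List.Relation.Unary.All.Properties as All
open import Data.List.Relation.Unary.Any using (here; there)
open import Data.Product using (_×_; _,_; Σ; proj₁; proj₂)
open import Data.Sum.Base as Sum using (_⊎_; inj₁; inj₂)
import Data.Unit.Polymorphic.Base as Unit
open import Function.Base using (_∘_)
open import Function.Bundles using (_⇔_; mk⇔)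
open import Relation.Binary.PropositionalEquality
  using (_≡_; refl; sym; trans; cong; cong₂; subst)

-- Families indexed by the entries of a list.

module _ {a p} {A : Set a} {P : A → Set p} where

  tabulate-cong : ∀ {xs} {f g : ∀ {x} → x ∈ xs → P x} →
    (∀ {x} (i : x ∈ xs) → f i ≡ g i) → tabulate f ≡ tabulate g
  tabulate-cong {[]}     f≗g = refl
  tabulate-cong {x ∷ xs} f≗g = cong₂ _∷_ (f≗g (here refl)) (tabulate-cong (f≗g ∘ there))

  tabulate∘lookup : ∀ {xs} (pxs : All P xs) → tabulate (lookup pxs) ≡ pxs
  tabulate∘lookup []         = refl
  tabulate∘lookup (px ∷ pxs) = cong (px ∷_) (tabulate∘lookup pxs)

  lookup∘tabulate : ∀ {xs} (f : ∀ {x} → x ∈ xs → P x) {x} (i : x ∈ xs) → lookup (tabulate f) i ≡ f i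
  lookup∘tabulate f (here refl) = refl
  lookup∘tabulate f (there i)   = lookup∘tabulate (f ∘ there) i

  lookup-++⁺ʳ : ∀ {xs ys} (pxs : All P xs) (pys : All P ys) {y} (i : y ∈ ys) →
    lookup (All.++⁺ pxs pys) (∈-++⁺ʳ xs i) ≡ lookup pys i
  lookup-++⁺ʳ []         pys i = refl
  lookup-++⁺ʳ (px ∷ pxs) pys i = lookup-++⁺ʳ pxs pys i

-- Equations of the substitution calculus.

module Substitutions {ℓ : Level} (S : Signature ℓ) where

  open Signature S
  open Syntax S
  open Sublist {A = Sort} using ([]; _∷_; _∷ʳ_; minimum)

  mutual
    []ᵗ-∘ : ∀ {Γ Δ Θ X} (t : Term Γ X) (σ : Sub Δ Γ) (τ : Sub Θ Δ) →
      t [ σ ]ᵗ [ τ ]ᵗ ≡ t [ σ [ τ ]ˢ ]ᵗ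
    []ᵗ-∘ (var x)    σ τ = lookup-[]ˢ σ τ x
    []ᵗ-∘ (app f ts) σ τ = cong (app f) ([]ˢ-∘ ts σ τ)

    []ˢ-∘ : ∀ {Γ Δ Θ Xs} (ts : Sub Γ Xs) (σ : Sub Δ Γ) (τ : Sub Θ Δ) →
      ts [ σ ]ˢ [ τ ]ˢ ≡ ts [ σ [ τ ]ˢ ]ˢ
    []ˢ-∘ []       σ τ = refl
    []ˢ-∘ (t ∷ ts) σ τ = cong₂ _∷_ ([]ᵗ-∘ t σ τ) ([]ˢ-∘ ts σ τ)

    lookup-[]ˢ : ∀ {Γ Δ Xs} (ts : Sub Γ Xs) (σ : Sub Δ Γ) {X} (x : X ∈ Xs) →
      lookup ts x [ σ ]ᵗ ≡ lookup (ts [ σ ]ˢ) x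
    lookup-[]ˢ (t ∷ ts) σ (here refl) = refl
    lookup-[]ˢ (t ∷ ts) σ (there x)   = lookup-[]ˢ ts σ x

  mutual
    []ᵗ-id : ∀ {Γ X} (t : Term Γ X) → t [ idˢ ]ᵗ ≡ t
    []ᵗ-id (var x)    = lookup∘tabulate var x
    []ᵗ-id (app f ts) = cong (app f) ([]ˢ-id ts)

    []ˢ-id : ∀ {Γ Xs} (ts : Sub Γ Xs) → ts [ idˢ ]ˢ ≡ ts
    []ˢ-id []       = refl
    []ˢ-id (t ∷ ts) = cong₂ _∷_ ([]ᵗ-id t) ([]ˢ-id ts)

  tabulate-[]ˢ : ∀ {Γ Δ Xs} (f : ∀ {X} → X ∈ Xs → Term Γ X) (σ : Sub Δ Γ) →
    tabulate f [ σ ]ˢ ≡ tabulate (λ x → f x [ σ ]ᵗ)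
  tabulate-[]ˢ {Xs = []}     f σ = refl
  tabulate-[]ˢ {Xs = X ∷ Xs} f σ = cong (f (here refl) [ σ ]ᵗ ∷_) (tabulate-[]ˢ (f ∘ there) σ)

  id-[]ˢ : ∀ {Γ Δ} (σ : Sub Δ Γ) → idˢ [ σ ]ˢ ≡ σ
  id-[]ˢ σ = trans (tabulate-[]ˢ var σ) (tabulate∘lookup σ)

  wk-[∷]ˢ : ∀ {Γ Δ Y} (t : Term Δ Y) (σ : Sub Δ Γ) → wkˢ [ t ∷ σ ]ˢ ≡ σ
  wk-[∷]ˢ t σ = trans (tabulate-[]ˢ (var ∘ there) (t ∷ σ)) (tabulate∘lookup σ)

  []ˢ-wk-[∷]ˢ : ∀ {Γ Δ Xs Y} (ts : Sub Γ Xs) (t : Term Δ Y) (σ : Sub Δ Γ) →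
    ts [ wkˢ ]ˢ [ t ∷ σ ]ˢ ≡ ts [ σ ]ˢ
  []ˢ-wk-[∷]ˢ ts t σ = trans ([]ˢ-∘ ts wkˢ (t ∷ σ)) (cong (ts [_]ˢ) (wk-[∷]ˢ t σ))

  lift-[∷]ˢ : ∀ {Γ Δ Θ Y} (σ : Sub Δ Γ) (t : Term Θ Y) (τ : Sub Θ Δ) →
    liftˢ Y σ [ t ∷ τ ]ˢ ≡ t ∷ σ [ τ ]ˢ
  lift-[∷]ˢ σ t τ = cong (t ∷_) ([]ˢ-wk-[∷]ˢ σ t τ)

  lift-∘ : ∀ {Γ Δ Θ} Y (σ : Sub Δ Γ) (τ : Sub Θ Δ) →
    liftˢ Y σ [ liftˢ Y τ ]ˢ ≡ liftˢ Y (σ [ τ ]ˢ)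
  lift-∘ Y σ τ = trans (lift-[∷]ˢ σ _ _) (cong (_ ∷_) (sym ([]ˢ-∘ σ τ wkˢ)))

  lift-id : ∀ {Γ} Y → liftˢ Y (idˢ {Γ}) ≡ idˢ
  lift-id Y = cong (_ ∷_) (id-[]ˢ wkˢ)

  vars-tabulate-[]ˢ : ∀ {Γ Δ Xs} (f : ∀ {X} → X ∈ Xs → X ∈ Γ) (σ : Sub Δ Γ) →
    vars (tabulate f) [ σ ]ˢ ≡ tabulate (λ x → lookup σ (f x))
  vars-tabulate-[]ˢ {Xs = []}     f σ = refl
  vars-tabulate-[]ˢ {Xs = X ∷ Xs} f σ =
    cong (lookup σ (f (here refl)) ∷_) (vars-tabulate-[]ˢ (f ∘ there) σ)

  lookup-replace : ∀ {Γ Δ Xs} (xs : Xs ⊆ Γ) (ts : Sub Δ Xs) (σ : Sub Δ Γ) {X} (x : X ∈ Xs) →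
    lookup (replace xs ts σ) (Sublist.lookup xs x) ≡ lookup ts x
  lookup-replace (_ ∷ʳ xs)   ts       (s ∷ σ) x           = lookup-replace xs ts σ x
  lookup-replace (refl ∷ xs) (t ∷ ts) (s ∷ σ) (here refl) = refl
  lookup-replace (refl ∷ xs) (t ∷ ts) (s ∷ σ) (there x)   = lookup-replace xs ts σ x

  chosen-replace : ∀ {Γ Δ Xs} (xs : Xs ⊆ Γ) (ts : Sub Δ Xs) (σ : Sub Δ Γ) →
    vars (chosen xs) [ replace xs ts σ ]ˢ ≡ ts
  chosen-replace xs ts σ = trans (vars-tabulate-[]ˢ (Sublist.lookup xs) (replace xs ts σ))
    (trans (tabulate-cong (lookup-replace xs ts σ)) (tabulate∘lookup ts))

  replace-[]ˢ : ∀ {Γ Δ Θ Xs} (xs : Xs ⊆ Γ) (ts : Sub Δ Xs) (σ : Sub Δ Γ) (τ : Sub Θ Δ) →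
    replace xs ts σ [ τ ]ˢ ≡ replace xs (ts [ τ ]ˢ) (σ [ τ ]ˢ)
  replace-[]ˢ []          []       []      τ = refl
  replace-[]ˢ (_ ∷ʳ xs)   ts       (s ∷ σ) τ = cong (_ ∷_) (replace-[]ˢ xs ts σ τ)
  replace-[]ˢ (refl ∷ xs) (t ∷ ts) (s ∷ σ) τ = cong (_ ∷_) (replace-[]ˢ xs ts σ τ)

  -- The variables to be replaced in `≐-subst` must be distinct, the replacing ones need not be.
  -- Hence `left` is a sublist, whereas `right` is merely a tuple of variables.
  left : (Γ : Ctx) {Δ : Ctx} → Γ ⊆ Γ ++ Δ
  left []      = minimum _
  left (X ∷ Γ) = refl ∷ left Γ

  right : (Γ : Ctx) {Δ : Ctx} → All (_∈ Γ ++ Δ) Δ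
  right Γ = tabulate (∈-++⁺ʳ Γ)

  lookup-left : ∀ {Γ Δ Θ} (σ : Sub Θ Γ) (τ : Sub Θ Δ) {X} (x : X ∈ Γ) →
    lookup (All.++⁺ σ τ) (Sublist.lookup (left Γ) x) ≡ lookup σ x
  lookup-left (s ∷ σ) τ (here refl) = refl
  lookup-left (s ∷ σ) τ (there x)   = lookup-left σ τ x

  left-[++]ˢ : ∀ {Γ Δ Θ} (σ : Sub Θ Γ) (τ : Sub Θ Δ) →
    vars (chosen (left Γ)) [ All.++⁺ σ τ ]ˢ ≡ σ
  left-[++]ˢ σ τ = trans (vars-tabulate-[]ˢ (Sublist.lookup (left _)) (All.++⁺ σ τ))
    (trans (tabulate-cong (lookup-left σ τ)) (tabulate∘lookup σ))

  right-[++]ˢ : ∀ {Γ Δ Θ} (σ : Sub Θ Γ) (τ : Sub Θ Δ) →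
    vars (right Γ) [ All.++⁺ σ τ ]ˢ ≡ τ
  right-[++]ˢ σ τ = trans (vars-tabulate-[]ˢ (∈-++⁺ʳ _) (All.++⁺ σ τ))
    (trans (tabulate-cong (lookup-++⁺ʳ σ τ)) (tabulate∘lookup τ))

  ≐*-[] : ∀ {Γ Δ Xs} (ss ts : Sub Γ Xs) (σ : Sub Δ Γ) →
    (ss ≐* ts) [ σ ] ≡ ss [ σ ]ˢ ≐* ts [ σ ]ˢ
  ≐*-[] []       []       σ = refl
  ≐*-[] (s ∷ ss) (t ∷ ts) σ = cong (_ ∧_) (≐*-[] ss ts σ)

  ≐*-geometric : ∀ {Γ Xs} (ss ts : Sub Γ Xs) → IsGeometric (ss ≐* ts)
  ≐*-geometric []       []       = ⊤
  ≐*-geometric (s ∷ ss) (t ∷ ts) = (s ≐ t) ∧ ≐*-geometric ss ts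

  []-geometric : ∀ {Γ Δ} {φ : Formula Γ} → IsGeometric φ → (σ : Sub Δ Γ) → IsGeometric (φ [ σ ])
  []-geometric (s ≐ t)    σ = (s [ σ ]ᵗ) ≐ (t [ σ ]ᵗ)
  []-geometric (rel R ts) σ = rel R (ts [ σ ]ˢ)
  []-geometric ⊤          σ = ⊤
  []-geometric ⊥          σ = ⊥
  []-geometric (φ ∧ ψ)    σ = []-geometric φ σ ∧ []-geometric ψ σ
  []-geometric (φ ∨ ψ)    σ = []-geometric φ σ ∨ []-geometric ψ σ
  []-geometric (⋁ φ)      σ = ⋁ λ i → []-geometric (φ i) σ
  []-geometric (ex φ)     σ = ex ([]-geometric φ (liftˢ _ σ))

-- Derived rules of geometric logic.

module GeometricLogic {ℓ : Level} (T : GeometricTheory ℓ) where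

  open GeometricTheory T
  open Substitutions signature
  open Deduction T

  infix 4 _⊢ᵍ_ _⊣⊢_

  _⊢ᵍ_ : ∀ {Γ} → Formula Γ → Formula Γ → Set (suc ℓ)
  φ ⊢ᵍ ψ = Derivation geometric (φ ⊢ ψ)

  _⊣⊢_ : ∀ {Γ} → Formula Γ → Formula Γ → Set (suc ℓ)
  φ ⊣⊢ ψ = (φ ⊢ᵍ ψ) × (ψ ⊢ᵍ φ)

  ∧-mono : ∀ {Γ} {φ φ′ ψ ψ′ : Formula Γ} → IsGeometric φ → IsGeometric ψ →
    φ ⊢ᵍ φ′ → ψ ⊢ᵍ ψ′ → φ ∧ ψ ⊢ᵍ φ′ ∧ ψ′
  ∧-mono gφ gψ d e = ∧-intro (cut (∧-elim₁ gφ gψ) d) (cut (∧-elim₂ gφ gψ) e)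

  ∨-mono : ∀ {Γ} {φ φ′ ψ ψ′ : Formula Γ} → IsGeometric φ′ → IsGeometric ψ′ →
    φ ⊢ᵍ φ′ → ψ ⊢ᵍ ψ′ → φ ∨ ψ ⊢ᵍ φ′ ∨ ψ′
  ∨-mono gφ gψ d e = ∨-elim (cut d (∨-intro₁ gφ gψ)) (cut e (∨-intro₂ gφ gψ))

  ⋁-mono : ∀ {Γ} {I : Set ℓ} {φ φ′ : I → Formula Γ} → (∀ i → IsGeometric (φ′ i)) →
    (∀ i → φ i ⊢ᵍ φ′ i) → ⋁ φ ⊢ᵍ ⋁ φ′
  ⋁-mono g d = ⋁-elim (⋁ g) λ i → cut (d i) (⋁-intro g i)

  ∃-mono : ∀ {Γ Y} {φ φ′ : Formula (Y ∷ Γ)} → IsGeometric φ′ → φ ⊢ᵍ φ′ → ex Y φ ⊢ᵍ ex Y φ′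
  ∃-mono g d = ∃-elim (cut d (∃-elim⁻¹ (identity (ex g))))

  -- The two sides need not be equal: comparing the families under ⋁ would take
  -- function extensionality.
  []-∘ : ∀ {Γ Δ Θ} {φ : Formula Γ} → IsGeometric φ → (σ : Sub Δ Γ) (τ : Sub Θ Δ) →
    φ [ σ ] [ τ ] ⊣⊢ φ [ σ [ τ ]ˢ ]
  []-∘ (s ≐ t) σ τ
    rewrite []ᵗ-∘ s σ τ | []ᵗ-∘ t σ τ = identity (_ ≐ _) , identity (_ ≐ _)
  []-∘ (rel R ts) σ τ
    rewrite []ˢ-∘ ts σ τ = identity (rel R _) , identity (rel R _)
  []-∘ ⊤ σ τ = identity ⊤ , identity ⊤
  []-∘ ⊥ σ τ = identity ⊥ , identity ⊥
  []-∘ (φ ∧ ψ) σ τ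
    using φ→ , φ← ← []-∘ φ σ τ | ψ→ , ψ← ← []-∘ ψ σ τ
    = ∧-mono ([]-geometric ([]-geometric φ σ) τ) ([]-geometric ([]-geometric ψ σ) τ) φ→ ψ→
    , ∧-mono ([]-geometric φ _) ([]-geometric ψ _) φ← ψ←
  []-∘ (φ ∨ ψ) σ τ
    using φ→ , φ← ← []-∘ φ σ τ | ψ→ , ψ← ← []-∘ ψ σ τ
    = ∨-mono ([]-geometric φ _) ([]-geometric ψ _) φ→ ψ→
    , ∨-mono ([]-geometric ([]-geometric φ σ) τ) ([]-geometric ([]-geometric ψ σ) τ) φ← ψ←
  []-∘ (⋁ φ) σ τ
    = ⋁-mono (λ i → []-geometric (φ i) _) (λ i → proj₁ ([]-∘ (φ i) σ τ))
    , ⋁-mono (λ i → []-geometric ([]-geometric (φ i) σ) τ) (λ i → proj₂ ([]-∘ (φ i) σ τ))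
  []-∘ (ex {Y} {φ} g) σ τ
    using φ→ , φ← ← subst (λ ρ → φ [ liftˢ Y σ ] [ liftˢ Y τ ] ⊣⊢ φ [ ρ ])
                          (lift-∘ Y σ τ) ([]-∘ g (liftˢ Y σ) (liftˢ Y τ))
    = ∃-mono ([]-geometric g _) φ→ , ∃-mono ([]-geometric ([]-geometric g _) _) φ←

  []-id : ∀ {Γ} {φ : Formula Γ} → IsGeometric φ → φ [ idˢ ] ⊣⊢ φ
  []-id (s ≐ t) rewrite []ᵗ-id s | []ᵗ-id t = identity (s ≐ t) , identity (s ≐ t)
  []-id (rel R ts) rewrite []ˢ-id ts = identity (rel R ts) , identity (rel R ts)
  []-id ⊤ = identity ⊤ , identity ⊤
  []-id ⊥ = identity ⊥ , identity ⊥
  []-id (φ ∧ ψ)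
    using φ→ , φ← ← []-id φ | ψ→ , ψ← ← []-id ψ
    = ∧-mono ([]-geometric φ _) ([]-geometric ψ _) φ→ ψ→ , ∧-mono φ ψ φ← ψ←
  []-id (φ ∨ ψ)
    using φ→ , φ← ← []-id φ | ψ→ , ψ← ← []-id ψ
    = ∨-mono φ ψ φ→ ψ→ , ∨-mono ([]-geometric φ _) ([]-geometric ψ _) φ← ψ←
  []-id (⋁ φ)
    = ⋁-mono φ (λ i → proj₁ ([]-id (φ i)))
    , ⋁-mono (λ i → []-geometric (φ i) _) (λ i → proj₂ ([]-id (φ i)))
  []-id (ex {Y} {φ} g)
    using φ→ , φ← ← subst (λ ρ → φ [ ρ ] ⊣⊢ φ) (sym (lift-id Y)) ([]-id g)
    = ∃-mono g φ→ , ∃-mono ([]-geometric g _) φ←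

  -- `⋁-elim` admits no side assumption, so the mixed rule first carries a copy of `α` into every
  -- disjunct.
  ⋁-cases : ∀ {Γ} {I : Set ℓ} {α χ : Formula Γ} {φ : I → Formula Γ} →
    IsGeometric α → IsGeometric χ → (∀ i → IsGeometric (φ i)) →
    α ⊢ᵍ ⋁ φ → (∀ i → α ∧ φ i ⊢ᵍ χ) → α ⊢ᵍ χ
  ⋁-cases gα gχ gφ d h =
    cut (∧-intro d (identity gα)) (cut (⋁-∧-distrib gφ gα) (⋁-elim gχ λ i →
      cut (∧-intro (∧-elim₂ (gφ i) gα) (∧-elim₁ (gφ i) gα)) (h i)))

  -- The rules distribute only ⋁ over ∧, so φ ∨ ψ is turned into a disjunction over Bool.
  ∨-cases : ∀ {Γ} {α χ φ ψ : Formula Γ} →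
    IsGeometric α → IsGeometric χ → IsGeometric φ → IsGeometric ψ →
    α ⊢ᵍ φ ∨ ψ → α ∧ φ ⊢ᵍ χ → α ∧ ψ ⊢ᵍ χ → α ⊢ᵍ χ
  ∨-cases {φ = φ} {ψ} gα gχ gφ gψ d h k = ⋁-cases gα gχ gfamily
    (cut d (∨-elim (⋁-intro gfamily (lift true)) (⋁-intro gfamily (lift false))))
    λ { (lift true) → h ; (lift false) → k }
    where
    family : Lift ℓ Bool → Formula _
    family (lift b) = if b then φ else ψ

    gfamily : ∀ b → IsGeometric (family b)
    gfamily (lift true)  = gφ
    gfamily (lift false) = gψ

  ∃-cases : ∀ {Γ Y} {α χ : Formula Γ} {φ : Formula (Y ∷ Γ)} →
    IsGeometric α → IsGeometric φ →
    α ⊢ᵍ ex Y φ → weaken α ∧ φ ⊢ᵍ weaken χ → α ⊢ᵍ χ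
  ∃-cases gα gφ d h =
    cut (∧-intro d (identity gα)) (cut (∃-∧-distrib gφ gα) (∃-elim
      (cut (∧-intro (∧-elim₂ gφ gα′) (∧-elim₁ gφ gα′)) h)))
    where gα′ = []-geometric gα wkˢ

  -- Applying `∃-elim⁻¹` to the identity gives the generic instance; substituting `t` for its
  -- variable gives this one. The other cuts only compose substitutions.
  ∃-intro : ∀ {Γ Δ Y} {α : Formula Δ} {φ : Formula (Y ∷ Γ)} → IsGeometric φ →
    (t : Term Δ Y) (σ : Sub Δ Γ) → α ⊢ᵍ φ [ t ∷ σ ] → α ⊢ᵍ ex Y φ [ σ ]
  ∃-intro {Y = Y} {φ = φ} gφ t σ d = cut d (cut
    (subst (λ υ → φ [ υ ] ⊢ᵍ φ [ liftˢ Y σ ] [ t ∷ idˢ ])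
      (trans (lift-[∷]ˢ σ t idˢ) (cong (t ∷_) ([]ˢ-id σ)))
      (proj₂ ([]-∘ gφ (liftˢ Y σ) (t ∷ idˢ))))
    (cut (substitution (t ∷ idˢ) (∃-elim⁻¹ (identity gψ)))
      (cut (subst (λ υ → weaken (ex Y φ [ σ ]) [ t ∷ idˢ ] ⊢ᵍ ex Y φ [ σ ] [ υ ])
          (wk-[∷]ˢ t idˢ) (proj₁ ([]-∘ gψ wkˢ (t ∷ idˢ))))
        (proj₁ ([]-id gψ)))))
    where gψ = []-geometric (ex gφ) σ

  -- Provable equality of tuples of terms.

  ⊢≐-refl : ∀ {Γ X} {α : Formula Γ} → IsGeometric α → (t : Term Γ X) → α ⊢ᵍ t ≐ t
  ⊢≐-refl gα t = cut (⊤-intro gα) (substitution (t ∷ []) ≐-refl)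

  ≐*-refl : ∀ {Γ Xs} {α : Formula Γ} → IsGeometric α → (ts : Sub Γ Xs) → α ⊢ᵍ ts ≐* ts
  ≐*-refl gα []       = ⊤-intro gα
  ≐*-refl gα (t ∷ ts) = ∧-intro (⊢≐-refl gα t) (≐*-refl gα ts)

  ≐*-++ : ∀ {Γ Xs Ys} {α : Formula Γ} (ss ts : Sub Γ Xs) {us vs : Sub Γ Ys} →
    α ⊢ᵍ ss ≐* ts → α ⊢ᵍ us ≐* vs → α ⊢ᵍ All.++⁺ ss us ≐* All.++⁺ ts vs
  ≐*-++ []       []       d e = e
  ≐*-++ (s ∷ ss) (t ∷ ts) d e = ∧-intro
    (cut d (∧-elim₁ (s ≐ t) (≐*-geometric ss ts)))
    (≐*-++ ss ts (cut d (∧-elim₂ (s ≐ t) (≐*-geometric ss ts))) e)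

  -- Leibniz's rule for arbitrary terms is the instance σ, τ of the rule for variables in
  -- the context Γ ++ Γ.
  transport : ∀ {Γ Δ} {φ : Formula Γ} {α : Formula Δ} → IsGeometric φ → (σ τ : Sub Δ Γ) →
    α ⊢ᵍ σ ≐* τ → α ⊢ᵍ φ [ σ ] → α ⊢ᵍ φ [ τ ]
  transport {Γ} {Δ} {φ} {α} gφ σ τ d e =
    cut (∧-intro d e) (cut (∧-mono (≐*-geometric σ τ) ([]-geometric gφ σ) equations source)
      (cut (substitution στ (≐-subst xs ys ([]-geometric gφ _))) target))
    where
    xs = left Γ {Γ}
    ys = right Γ {Γ}
    στ = All.++⁺ σ τ
    ρ  = replace xs (vars ys) idˢ

    equations : σ ≐* τ ⊢ᵍ (vars (chosen xs) ≐* vars ys) [ στ ]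
    equations rewrite ≐*-[] (vars (chosen xs)) (vars ys) στ | left-[++]ˢ σ τ | right-[++]ˢ σ τ =
      identity (≐*-geometric σ τ)

    source : φ [ σ ] ⊢ᵍ φ [ vars (chosen xs) ] [ στ ]
    source = subst (λ υ → φ [ υ ] ⊢ᵍ φ [ vars (chosen xs) ] [ στ ]) (left-[++]ˢ σ τ)
      (proj₂ ([]-∘ gφ (vars (chosen xs)) στ))

    target : φ [ vars (chosen xs) ] [ ρ ] [ στ ] ⊢ᵍ φ [ τ ]
    target = cut (substitution στ (proj₁ ([]-∘ gφ (vars (chosen xs)) ρ)))
      (subst (λ υ → φ [ vars (chosen xs) [ ρ ]ˢ ] [ στ ] ⊢ᵍ φ [ υ ])
        (trans (cong (_[ στ ]ˢ) (chosen-replace xs (vars ys) idˢ)) (right-[++]ˢ σ τ))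
        (proj₁ ([]-∘ gφ (vars (chosen xs) [ ρ ]ˢ) στ)))

  private
    -- The disjoint union of the contexts allows each side to be rewritten independently.
    module _ {Γ Δ Xs} (ss : Sub Γ Xs) (ts : Sub Δ Xs) where

      sides : Formula (Γ ++ Δ)
      sides = ss [ vars (chosen (left Γ)) ]ˢ ≐* ts [ vars (right Γ) ]ˢ

      sides-[++] : ∀ {Θ} (σ : Sub Θ Γ) (τ : Sub Θ Δ) →
        sides [ All.++⁺ σ τ ] ≡ ss [ σ ]ˢ ≐* ts [ τ ]ˢ
      sides-[++] σ τ = trans (≐*-[] _ _ (All.++⁺ σ τ)) (cong₂ _≐*_
        (trans ([]ˢ-∘ ss _ _) (cong (ss [_]ˢ) (left-[++]ˢ σ τ)))
        (trans ([]ˢ-∘ ts _ _) (cong (ts [_]ˢ) (right-[++]ˢ σ τ))))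

      sides-geometric : IsGeometric sides
      sides-geometric = ≐*-geometric (ss [ vars (chosen (left Γ)) ]ˢ) (ts [ vars (right Γ) ]ˢ)

  -- Leibniz's rule for the formula `sides`. Congruence, symmetry and transitivity are all instances
  -- of it.
  ≐*-transport : ∀ {Γ Δ Θ Xs} {α : Formula Θ} (ss : Sub Γ Xs) (ts : Sub Δ Xs)
    (σ σ′ : Sub Θ Γ) (τ τ′ : Sub Θ Δ) → α ⊢ᵍ σ ≐* σ′ → α ⊢ᵍ τ ≐* τ′ →
    α ⊢ᵍ ss [ σ ]ˢ ≐* ts [ τ ]ˢ → α ⊢ᵍ ss [ σ′ ]ˢ ≐* ts [ τ′ ]ˢ
  ≐*-transport ss ts σ σ′ τ τ′ d e h = subst (_ ⊢ᵍ_) (sides-[++] ss ts σ′ τ′)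
    (transport (sides-geometric ss ts) (All.++⁺ σ τ) (All.++⁺ σ′ τ′) (≐*-++ σ σ′ d e)
      (subst (_ ⊢ᵍ_) (sym (sides-[++] ss ts σ τ)) h))

  ≐*-cong : ∀ {Γ Δ Xs} {α : Formula Δ} → IsGeometric α → (ss : Sub Γ Xs) (σ τ : Sub Δ Γ) →
    α ⊢ᵍ σ ≐* τ → α ⊢ᵍ ss [ σ ]ˢ ≐* ss [ τ ]ˢ
  ≐*-cong gα ss σ τ d = ≐*-transport ss ss σ σ σ τ (≐*-refl gα σ) d (≐*-refl gα (ss [ σ ]ˢ))

  ≐*-sym : ∀ {Γ Xs} {α : Formula Γ} → IsGeometric α → (ss ts : Sub Γ Xs) →
    α ⊢ᵍ ss ≐* ts → α ⊢ᵍ ts ≐* ss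
  ≐*-sym gα ss ts d = subst (_ ⊢ᵍ_) (cong₂ _≐*_ (id-[]ˢ ts) (id-[]ˢ ss))
    -- In the reflexive equation of `ss` with itself, only the left side is rewritten along `d`.
    (≐*-transport idˢ idˢ ss ts ss ss d (≐*-refl gα ss) (≐*-refl gα (idˢ [ ss ]ˢ)))

  ≐*-trans : ∀ {Γ Xs} {α : Formula Γ} → IsGeometric α → (ss ts us : Sub Γ Xs) →
    α ⊢ᵍ ss ≐* ts → α ⊢ᵍ ts ≐* us → α ⊢ᵍ ss ≐* us
  ≐*-trans gα ss ts us d e = subst (_ ⊢ᵍ_) (cong₂ _≐*_ (id-[]ˢ ss) (id-[]ˢ us))
    (≐*-transport idˢ idˢ ss ss ts us (≐*-refl gα ss) e
      (subst (_ ⊢ᵍ_) (sym (cong₂ _≐*_ (id-[]ˢ ss) (id-[]ˢ ts))) d))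

  open Sublist {A = Signature.Sort signature} using ([]; _∷_; _∷ʳ_)

  -- Entries outside `xs` are unchanged and need only reflexivity; the others are equated by the
  -- hypothesis. This turns the equations in `≐-subst` into a change of environment.
  ≐*-replace : ∀ {Γ Δ Xs} {α : Formula Δ} → IsGeometric α →
    (xs : Xs ⊆ Γ) (ts : Sub Δ Xs) (σ : Sub Δ Γ) →
    α ⊢ᵍ tabulate (λ x → lookup σ (Sublist.lookup xs x)) ≐* ts → α ⊢ᵍ σ ≐* replace xs ts σ
  ≐*-replace gα []          []       []      d = ⊤-intro gα
  ≐*-replace gα (_ ∷ʳ xs)   ts       (s ∷ σ) d = ∧-intro (⊢≐-refl gα s) (≐*-replace gα xs ts σ d)
  ≐*-replace gα (refl ∷ xs) (t ∷ ts) (s ∷ σ) d = ∧-intro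
    (cut d (∧-elim₁ (s ≐ t) (≐*-geometric _ ts)))
    (≐*-replace gα xs ts σ (cut d (∧-elim₂ (s ≐ t) (≐*-geometric _ ts))))

-- Worlds and their order.

module Semantics {ℓ : Level} (T : GeometricTheory ℓ) where

  open GeometricTheory T
  open Substitutions signature
  open Deduction T
  open GeometricLogic T

  -- The part of a world independent of the context `Γ` of the interpreted formula. It stays fixed
  -- when an environment is extended, substituted or relabelled.
  record Stage : Set (suc ℓ) where
    constructor stage
    field
      {context}            : Ctx
      {assumption}         : Formula context
      {goal}               : Formula context
      assumption-geometric : IsGeometric assumption
      goal-geometric       : IsGeometric goal

  record World (Γ : Ctx) : Set (suc ℓ) where
    constructor _,_
    field
      base : Stage
    open Stage base public
    field
      env : Sub context Γ

  open World

  infix 4 _≤_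

  -- As assignments are compared up to provable equality only, monotonicity of ⟦ φ ⟧ already
  -- contains the soundness of ≐-subst.
  record _≤_ {Γ} (v w : World Γ) : Set (suc ℓ) where
    field
      along       : Sub (context v) (context w)
      assumption≤ : assumption v ⊢ᵍ assumption w [ along ]
      goal≤       : goal w [ along ] ⊢ᵍ goal v
      env≤        : assumption v ⊢ᵍ env w [ along ]ˢ ≐* env v

  open _≤_

  -- This is how equations proved by the assumption act on the semantics: with `⟦_⟧-mono`, truth
  -- passes between provably equal environments.
  relabel : ∀ {Γ b} {σ τ : Sub (Stage.context b) Γ} →
    Stage.assumption b ⊢ᵍ σ ≐* τ → (b , τ) ≤ (b , σ)
  relabel {b = b} {σ} {τ} d = record
    { along       = idˢ
    ; assumption≤ = proj₂ ([]-id (Stage.assumption-geometric b))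
    ; goal≤       = proj₁ ([]-id (Stage.goal-geometric b))
    ; env≤        = subst (λ υ → _ ⊢ᵍ υ ≐* τ) (sym ([]ˢ-id σ)) d
    }

  ≤-refl : ∀ {Γ} {w : World Γ} → w ≤ w
  ≤-refl {w = w} = relabel (≐*-refl (assumption-geometric w) (env w))

  ≤-trans : ∀ {Γ} {u v w : World Γ} → u ≤ v → v ≤ w → u ≤ w
  ≤-trans {u = u} {v} {w} f g = record
    { along       = along g [ along f ]ˢ
    ; assumption≤ = cut (assumption≤ f) (cut (substitution (along f) (assumption≤ g))
                      (proj₁ ([]-∘ (assumption-geometric w) (along g) (along f))))
    ; goal≤       = cut (proj₂ ([]-∘ (goal-geometric w) (along g) (along f)))
                      (cut (substitution (along f) (goal≤ g)) (goal≤ f))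
    ; env≤        = ≐*-trans (assumption-geometric u) _ (env v [ along f ]ˢ) (env u)
                      (cut (assumption≤ f) (subst (_ ⊢ᵍ_)
                        (trans (≐*-[] (env w [ along g ]ˢ) (env v) (along f))
                          (cong (_≐* env v [ along f ]ˢ) ([]ˢ-∘ (env w) (along g) (along f))))
                        (substitution (along f) (env≤ g))))
                      (env≤ f)
    }

  -- Predicates on worlds and relative double negation.

  Solved : ∀ {Γ} → World Γ → Set (suc ℓ)
  Solved w = assumption w ⊢ᵍ goal w

  Solved-mono : ∀ {Γ} {v w : World Γ} → v ≤ w → Solved w → Solved v
  Solved-mono f d = cut (assumption≤ f) (cut (substitution (along f) d) (goal≤ f))

  Provable : ∀ {Γ} → Formula Γ → World Γ → Set (suc ℓ)
  Provable φ w = assumption w ⊢ᵍ φ [ env w ]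

  -- Substitution along `f` reaches the environment `env w [ along f ]ˢ`, which is only provably
  -- equal to `env v`; Leibniz's rule covers the difference.
  Provable-mono : ∀ {Γ} {φ : Formula Γ} → IsGeometric φ →
    ∀ {v w} → v ≤ w → Provable φ w → Provable φ v
  Provable-mono gφ {v} {w} f d = transport gφ (env w [ along f ]ˢ) (env v) (env≤ f)
    (cut (assumption≤ f) (cut (substitution (along f) d) (proj₁ ([]-∘ gφ (env w) (along f)))))

  -- Worlds and derivations both live in `Set (suc ℓ)`, so `J` does not raise the level and all
  -- formulas are interpreted in one universe.
  Pred : Ctx → Set (suc (suc ℓ))
  Pred Γ = World Γ → Set (suc ℓ)

  Monotone : ∀ {Γ} → Pred Γ → Set (suc ℓ)
  Monotone A = ∀ {v w} → v ≤ w → A w → A v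

  -- Double negation relative to Solved.
  J : ∀ {Γ} → Pred Γ → Pred Γ
  J A w = ∀ {v} → v ≤ w → (∀ {u} → u ≤ v → A u → Solved u) → Solved v

  Closed : ∀ {Γ} → Pred Γ → Set (suc ℓ)
  Closed A = ∀ {w} → J A w → A w

  module _ {Γ} {A : Pred Γ} where

    J-unit : Monotone A → ∀ {w} → A w → J A w
    J-unit A-mono a f k = k ≤-refl (A-mono f a)

    J-mono : Monotone (J A)
    J-mono f a g = a (≤-trans g f)

    J-closed : Closed (J A)
    J-closed a f k = a f λ g b → b ≤-refl λ h → k (≤-trans h g)

    -- A closed conclusion allows a double negation to be stripped from a premise. The elimination
    -- rules for disjunctions and existential quantifiers rest on this.
    J-bind : ∀ {B : Pred Γ} → Closed B → ∀ {w} → (∀ {v} → v ≤ w → A v → B v) → J A w → B w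
    J-bind B-closed h a = B-closed λ f k → a f λ g x → k g (h (≤-trans g f) x)

    J-map : ∀ {B : Pred Γ} → (∀ {w} → A w → B w) → ∀ {w} → J A w → J B w
    J-map h a f k = a f λ g x → k g (h x)

  -- Change of environment.

  infixl 5 _·_ _▹_

  _·_ : ∀ {Γ Γ′} → World Γ → Sub Γ Γ′ → World Γ′
  (b , e) · σ = b , (σ [ e ]ˢ)

  ·-mono : ∀ {Γ Γ′ v w} (σ : Sub Γ Γ′) → v ≤ w → v · σ ≤ w · σ
  ·-mono {v = v} {w} σ f = record
    { along       = along f
    ; assumption≤ = assumption≤ f
    ; goal≤       = goal≤ f
    ; env≤        = subst (λ υ → _ ⊢ᵍ υ ≐* σ [ env v ]ˢ) (sym ([]ˢ-∘ σ (env w) (along f)))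
                      (≐*-cong (assumption-geometric v) σ _ _ (env≤ f))
    }

  module _ {Γ Γ′} {σ : Sub Γ Γ′} {w : World Γ} {v : World Γ′} (f : v ≤ w · σ) where

    -- A world below `w · σ` need not have the form `u · σ`. Over the same stage, `restrict`
    -- provides such a `u` below `w`, up to provable equality of environments.
    restrict : World Γ
    restrict = base v , (env w [ along f ]ˢ)

    restrict-≤ : restrict ≤ w
    restrict-≤ = record
      { along       = along f
      ; assumption≤ = assumption≤ f
      ; goal≤       = goal≤ f
      ; env≤        = ≐*-refl (assumption-geometric v) (env restrict)
      }

    restrict-env : assumption v ⊢ᵍ env (restrict · σ) ≐* env v
    restrict-env = subst (λ υ → _ ⊢ᵍ υ ≐* env v) ([]ˢ-∘ σ (env w) (along f)) (env≤ f)

    restrict-env⁻¹ : assumption v ⊢ᵍ env v ≐* env (restrict · σ)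
    restrict-env⁻¹ = ≐*-sym (assumption-geometric v) (env (restrict · σ)) (env v) restrict-env

  module _ {Γ Γ′} {A : Pred Γ} {B : Pred Γ′} {σ : Sub Γ Γ′} where

    -- `Solved` depends on the stage only, so solving `restrict f` solves `v`.
    J-pull : (∀ {w} → A w → B (w · σ)) → ∀ {w} → J A w → J B (w · σ)
    J-pull h a f k = a (restrict-≤ f) λ g x →
      k (≤-trans (·-mono σ g) (relabel (restrict-env⁻¹ f))) (h x)

    J-push : Monotone B → (∀ {w} → B (w · σ) → A w) → ∀ {w} → J B (w · σ) → J A w
    J-push B-mono h b f k = b (·-mono σ f) λ g y →
      k (restrict-≤ g) (h (B-mono (relabel (restrict-env⁻¹ g)) y))

  _▹_ : ∀ {Γ Y} (w : World Γ) → Term (context w) Y → World (Y ∷ Γ)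
  (b , e) ▹ t = b , (t ∷ e)

  ▹-mono : ∀ {Γ Y} {v w : World Γ} (f : v ≤ w) (t : Term (context w) Y) → v ▹ t [ along f ]ᵗ ≤ w ▹ t
  ▹-mono {v = v} f t = record
    { along       = along f
    ; assumption≤ = assumption≤ f
    ; goal≤       = goal≤ f
    ; env≤        = ∧-intro (⊢≐-refl (assumption-geometric v) _) (env≤ f)
    }

  ▹-relabel : ∀ {Γ Y b} {σ τ : Sub (Stage.context b) Γ} (t : Term (Stage.context b) Y) →
    Stage.assumption b ⊢ᵍ σ ≐* τ → (b , τ) ▹ t ≤ (b , σ) ▹ t
  ▹-relabel {b = b} t d = relabel (∧-intro (⊢≐-refl (Stage.assumption-geometric b) t) d)

  ▹-wk : ∀ {Γ Y} (w : World Γ) (t : Term (context w) Y) → (w ▹ t) · wkˢ ≡ w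
  ▹-wk (b , e) t = cong (b ,_) (wk-[∷]ˢ t e)

  wk-▹ : ∀ {Γ Y} (w : World (Y ∷ Γ)) → w · wkˢ ▹ lookup (env w) (here refl) ≡ w
  wk-▹ (b , (t ∷ e)) = cong (λ υ → b , (t ∷ υ)) (wk-[∷]ˢ t e)

  ▹-lift : ∀ {Γ Γ′ Y} (w : World Γ) (σ : Sub Γ Γ′) (t : Term (context w) Y) →
    (w ▹ t) · liftˢ Y σ ≡ w · σ ▹ t
  ▹-lift (b , e) σ t = cong (b ,_) (lift-[∷]ˢ σ t e)

  -- The interpretation of formulas.

  -- Kripke forcing, with `J` inserted at atoms, disjunctions and existential quantifiers. `Solved`
  -- is closed already, and the remaining connectives preserve closure.
  ⟦_⟧ : ∀ {Γ} → Formula Γ → Pred Γ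
  ⟦ s ≐ t ⟧    = J (Provable (s ≐ t))
  ⟦ rel R ts ⟧ = J (Provable (rel R ts))
  ⟦ ⊤ ⟧        = λ _ → Unit.⊤
  ⟦ ⊥ ⟧        = Solved
  ⟦ φ ∧ ψ ⟧    = λ w → ⟦ φ ⟧ w × ⟦ ψ ⟧ w
  ⟦ φ ∨ ψ ⟧    = J λ w → ⟦ φ ⟧ w ⊎ ⟦ ψ ⟧ w
  ⟦ φ ⇒ ψ ⟧    = λ w → ∀ {v} → v ≤ w → ⟦ φ ⟧ v → ⟦ ψ ⟧ v
  ⟦ ⋀ φ ⟧      = λ w → ∀ i → ⟦ φ i ⟧ w
  ⟦ ⋁ {I} φ ⟧  = J λ w → Σ I λ i → ⟦ φ i ⟧ w
  ⟦ all Y φ ⟧  = λ w → ∀ {v} → v ≤ w → (t : Term (context v) Y) → ⟦ φ ⟧ (v ▹ t)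
  ⟦ ex Y φ ⟧   = J λ w → Σ (Term (context w) Y) λ t → ⟦ φ ⟧ (w ▹ t)

  ⟦_⟧-mono : ∀ {Γ} (φ : Formula Γ) → Monotone ⟦ φ ⟧
  ⟦ s ≐ t ⟧-mono            = J-mono
  ⟦ rel R ts ⟧-mono         = J-mono
  ⟦ ⊤ ⟧-mono    f a         = a
  ⟦ ⊥ ⟧-mono                = Solved-mono
  ⟦ φ ∧ ψ ⟧-mono f (a , b)  = ⟦ φ ⟧-mono f a , ⟦ ψ ⟧-mono f b
  ⟦ φ ∨ ψ ⟧-mono            = J-mono
  ⟦ φ ⇒ ψ ⟧-mono f h g      = h (≤-trans g f)
  ⟦ ⋀ φ ⟧-mono   f a i      = ⟦ φ i ⟧-mono f (a i)
  ⟦ ⋁ φ ⟧-mono              = J-mono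
  ⟦ all Y φ ⟧-mono f h g    = h (≤-trans g f)
  ⟦ ex Y φ ⟧-mono           = J-mono

  ⊎-mono : ∀ {Γ} (φ ψ : Formula Γ) → Monotone λ w → ⟦ φ ⟧ w ⊎ ⟦ ψ ⟧ w
  ⊎-mono φ ψ f = Sum.map (⟦ φ ⟧-mono f) (⟦ ψ ⟧-mono f)

  Σ-mono : ∀ {Γ} {I : Set ℓ} (φ : I → Formula Γ) → Monotone λ w → Σ I λ i → ⟦ φ i ⟧ w
  Σ-mono φ f (i , a) = i , ⟦ φ i ⟧-mono f a

  ▹Σ-mono : ∀ {Γ Y} (φ : Formula (Y ∷ Γ)) →
    Monotone λ w → Σ (Term (context w) Y) λ t → ⟦ φ ⟧ (w ▹ t)
  ▹Σ-mono φ f (t , a) = t [ along f ]ᵗ , ⟦ φ ⟧-mono (▹-mono f t) a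

  ⟦_⟧-closed : ∀ {Γ} (φ : Formula Γ) → Closed ⟦ φ ⟧
  ⟦ s ≐ t ⟧-closed      = J-closed
  ⟦ rel R ts ⟧-closed   = J-closed
  ⟦ ⊤ ⟧-closed        _ = _
  ⟦ ⊥ ⟧-closed        a = a ≤-refl λ _ d → d
  ⟦ φ ∧ ψ ⟧-closed    a = ⟦ φ ⟧-closed (J-map proj₁ a) , ⟦ ψ ⟧-closed (J-map proj₂ a)
  ⟦ φ ∨ ψ ⟧-closed      = J-closed
  ⟦ φ ⇒ ψ ⟧-closed  h f a =
    J-bind ⟦ ψ ⟧-closed (λ g k → k ≤-refl (⟦ φ ⟧-mono g a)) (J-mono f h)
  ⟦ ⋀ φ ⟧-closed    a i = ⟦ φ i ⟧-closed (J-map (λ b → b i) a)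
  ⟦ ⋁ φ ⟧-closed        = J-closed
  ⟦ all Y φ ⟧-closed {w} h {v} f t =
    -- The hypothesis lives over `Γ`, the conclusion over `Y ∷ Γ`. So view `v` as `(v ▹ t) · wkˢ`,
    -- and instantiate the universal formula at the head of each environment reached.
    ⟦ φ ⟧-closed (J-push ⟦ all Y φ ⟧-mono
      (λ {u} k → subst ⟦ φ ⟧ (wk-▹ u) (k ≤-refl (lookup (env u) (here refl))))
      (subst (J ⟦ all Y φ ⟧) (sym (▹-wk v t)) (J-mono f h)))
  ⟦ ex Y φ ⟧-closed     = J-closed

  -- The substitution lemma.

  mutual
    -- The two directions are proved together because the premise of an implication exchanges them.
    pull : ∀ {Γ Γ′} (φ : Formula Γ′) (σ : Sub Γ Γ′) {w} → ⟦ φ [ σ ] ⟧ w → ⟦ φ ⟧ (w · σ)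
    pull (s ≐ t)    σ   = J-pull λ {w} d → cut d (proj₁ ([]-∘ (s ≐ t) σ (env w)))
    pull (rel R ts) σ   = J-pull λ {w} d → cut d (proj₁ ([]-∘ (rel R ts) σ (env w)))
    pull ⊤          σ a = a
    pull ⊥          σ d = d
    pull (φ ∧ ψ)    σ (a , b) = pull φ σ a , pull ψ σ b
    pull (φ ∨ ψ)    σ   = J-pull (Sum.map (pull φ σ) (pull ψ σ))
    pull (φ ⇒ ψ)    σ h f a =
      ⟦ ψ ⟧-mono (relabel (restrict-env f)) (pull ψ σ (h (restrict-≤ f)
        (push φ σ (⟦ φ ⟧-mono (relabel (restrict-env⁻¹ f)) a))))
    pull (⋀ φ)      σ a i = pull (φ i) σ (a i)
    pull (⋁ φ)      σ   = J-pull λ (i , a) → i , pull (φ i) σ a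
    pull (all Y φ)  σ h f t =
      ⟦ φ ⟧-mono (▹-relabel t (restrict-env f)) (subst ⟦ φ ⟧ (▹-lift (restrict f) σ t)
        (pull φ (liftˢ Y σ) (h (restrict-≤ f) t)))
    pull (ex Y φ)   σ   = J-pull λ {w} (t , a) →
      t , subst ⟦ φ ⟧ (▹-lift w σ t) (pull φ (liftˢ Y σ) a)

    push : ∀ {Γ Γ′} (φ : Formula Γ′) (σ : Sub Γ Γ′) {w} → ⟦ φ ⟧ (w · σ) → ⟦ φ [ σ ] ⟧ w
    push (s ≐ t)    σ   = J-push (Provable-mono (s ≐ t)) λ {w} d →
      cut d (proj₂ ([]-∘ (s ≐ t) σ (env w)))
    push (rel R ts) σ   = J-push (Provable-mono (rel R ts)) λ {w} d →
      cut d (proj₂ ([]-∘ (rel R ts) σ (env w)))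
    push ⊤          σ a = a
    push ⊥          σ d = d
    push (φ ∧ ψ)    σ (a , b) = push φ σ a , push ψ σ b
    push (φ ∨ ψ)    σ   = J-push (⊎-mono φ ψ) (Sum.map (push φ σ) (push ψ σ))
    push (φ ⇒ ψ)    σ h f a = push ψ σ (h (·-mono σ f) (pull φ σ a))
    push (⋀ φ)      σ a i = push (φ i) σ (a i)
    push (⋁ φ)      σ   = J-push (Σ-mono φ) λ (i , a) → i , push (φ i) σ a
    push (all Y φ)  σ h {v} f t =
      push φ (liftˢ Y σ) (subst ⟦ φ ⟧ (sym (▹-lift v σ t)) (h (·-mono σ f) t))
    push (ex Y φ)   σ   = J-push (▹Σ-mono φ) λ {w} (t , a) →
      t , push φ (liftˢ Y σ) (subst ⟦ φ ⟧ (sym (▹-lift w σ t)) a)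

  pull-wk : ∀ {Γ Y} (φ : Formula Γ) {w} {t : Term (context w) Y} → ⟦ weaken φ ⟧ (w ▹ t) → ⟦ φ ⟧ w
  pull-wk φ {w} {t} a = subst ⟦ φ ⟧ (▹-wk w t) (pull φ wkˢ a)

  push-wk : ∀ {Γ Y} (φ : Formula Γ) {w} {t : Term (context w) Y} → ⟦ φ ⟧ w → ⟦ weaken φ ⟧ (w ▹ t)
  push-wk φ {w} {t} a = push φ wkˢ (subst ⟦ φ ⟧ (sym (▹-wk w t)) a)

  -- Truth and provability of geometric formulas.

  assume : ∀ {Γ} (w : World Γ) {φ : Formula (context w)} → IsGeometric φ → World Γ
  assume (stage gα gχ , e) gφ = stage (gα ∧ gφ) gχ , e

  assume-≤ : ∀ {Γ} (w : World Γ) {φ : Formula (context w)} (gφ : IsGeometric φ) → assume w gφ ≤ w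
  assume-≤ w gφ = record
    { along       = idˢ
    ; assumption≤ = cut (∧-elim₁ (assumption-geometric w) gφ)
                      (proj₂ ([]-id (assumption-geometric w)))
    ; goal≤       = proj₁ ([]-id (goal-geometric w))
    ; env≤        = subst (λ υ → _ ⊢ᵍ υ ≐* env w) (sym ([]ˢ-id (env w)))
                      (≐*-refl (assumption-geometric w ∧ gφ) (env w))
    }

  fresh : ∀ {Γ Y} (w : World Γ) {φ : Formula (Y ∷ context w)} → IsGeometric φ → World Γ
  fresh (stage gα gχ , e) gφ = stage ([]-geometric gα wkˢ ∧ gφ) ([]-geometric gχ wkˢ) , (e [ wkˢ ]ˢ)

  fresh-≤ : ∀ {Γ Y} (w : World Γ) {φ : Formula (Y ∷ context w)}
    (gφ : IsGeometric φ) → fresh w gφ ≤ w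
  fresh-≤ w gφ = record
    { along       = wkˢ
    ; assumption≤ = ∧-elim₁ ([]-geometric (assumption-geometric w) wkˢ) gφ
    ; goal≤       = identity ([]-geometric (goal-geometric w) wkˢ)
    ; env≤        = ≐*-refl (assumption-geometric (fresh w gφ)) (env w [ wkˢ ]ˢ)
    }

  -- To prove `J`, only the goal of a world has to be derived. It is geometric, so case analysis
  -- inside geometric logic may conclude with it.
  reflect : ∀ {Γ} {φ : Formula Γ} → IsGeometric φ → ∀ {w} → Provable φ w → ⟦ φ ⟧ w
  reflect (s ≐ t)    d = J-unit (Provable-mono (s ≐ t)) d
  reflect (rel R ts) d = J-unit (Provable-mono (rel R ts)) d
  reflect ⊤          d = _
  reflect ⊥      {w} d = cut d (⊥-elim (goal-geometric w))
  reflect (φ ∧ ψ) {w} d =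
    reflect φ (cut d (∧-elim₁ gφ gψ)) , reflect ψ (cut d (∧-elim₂ gφ gψ))
    where
    gφ = []-geometric φ (env w)
    gψ = []-geometric ψ (env w)
  reflect (φ ∨ ψ) d {v} f k = ∨-cases gα (goal-geometric v) gφ gψ (Provable-mono (φ ∨ ψ) f d)
    (k (assume-≤ v gφ) (inj₁ (reflect φ (∧-elim₂ gα gφ))))
    (k (assume-≤ v gψ) (inj₂ (reflect ψ (∧-elim₂ gα gψ))))
    where
    gα = assumption-geometric v
    gφ = []-geometric φ (env v)
    gψ = []-geometric ψ (env v)
  reflect (⋁ φ) d {v} f k = ⋁-cases gα (goal-geometric v) gφ (Provable-mono (⋁ φ) f d)
    λ i → k (assume-≤ v (gφ i)) (i , reflect (φ i) (∧-elim₂ gα (gφ i)))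
    where
    gα = assumption-geometric v
    gφ = λ i → []-geometric (φ i) (env v)
  reflect (ex {Y} φ) d {v} f k = ∃-cases gα gφ (Provable-mono (ex φ) f d)
    -- The witness is the new variable. The environment of `fresh v gφ` extended by it is
    -- `liftˢ Y (env v)` by definition, so the added assumption is the required instance of the
    -- body.
    (k (fresh-≤ v gφ) (var (here refl) , reflect φ (∧-elim₂ ([]-geometric gα wkˢ) gφ)))
    where
    gα = assumption-geometric v
    gφ = []-geometric φ (liftˢ Y (env v))

  -- The head of the environment is the witness. The form `w · wkˢ` is the one that `J-pull`
  -- expects.
  ∃-provable : ∀ {Γ Y} {φ : Formula (Y ∷ Γ)} → IsGeometric φ → ∀ {w} →
    Provable φ w → Provable (ex Y φ) (w · wkˢ)
  ∃-provable {Y = Y} {φ} gφ {b , (t ∷ e)} d =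
    subst (λ υ → _ ⊢ᵍ ex Y φ [ υ ]) (sym (wk-[∷]ˢ t e)) (∃-intro gφ t e d)

  -- Atoms, disjuncts and witnesses are available only under `J`, which therefore remains in the
  -- conclusion.
  reify : ∀ {Γ} {φ : Formula Γ} → IsGeometric φ → ∀ {w} → ⟦ φ ⟧ w → J (Provable φ) w
  reify (s ≐ t)    a = a
  reify (rel R ts) a = a
  reify ⊤ {w}      a = J-unit (Provable-mono ⊤) (⊤-intro (assumption-geometric w))
  reify ⊥          d = λ f _ → Solved-mono f d
  reify (φ ∧ ψ) (a , b) = J-bind J-closed (λ f c → J-bind J-closed (λ g d →
      J-unit (Provable-mono (φ ∧ ψ)) (∧-intro (Provable-mono φ g c) d)) (J-mono f (reify ψ b)))
    (reify φ a)
  reify (φ ∨ ψ) a = J-bind J-closed (λ _ → λ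
    { (inj₁ b) → J-map (λ {v} d →
        cut d (∨-intro₁ ([]-geometric φ (env v)) ([]-geometric ψ (env v)))) (reify φ b)
    ; (inj₂ b) → J-map (λ {v} d →
        cut d (∨-intro₂ ([]-geometric φ (env v)) ([]-geometric ψ (env v)))) (reify ψ b)
    }) a
  reify (⋁ φ) a = J-bind J-closed (λ _ (i , b) →
    J-map (λ {v} d → cut d (⋁-intro (λ j → []-geometric (φ j) (env v)) i)) (reify (φ i) b)) a
  reify (ex {Y} {φ} g) a = J-bind J-closed (λ {v} _ (t , b) →
    subst (J (Provable (ex Y φ))) (▹-wk v t)
      (J-pull {A = Provable φ} {B = Provable (ex Y φ)} {σ = wkˢ} (λ {u} → ∃-provable g {u})
        (reify g b))) a

  -- Soundness of classical logic and conservativity.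

  sound : ∀ {σ} → Derivation classical σ →
    ∀ {w} → ⟦ Sequent.antecedent σ ⟧ w → ⟦ Sequent.succedent σ ⟧ w
  -- Both sides are geometric: the antecedent becomes provable, the axiom is applied inside
  -- geometric logic, and the provable succedent becomes true.
  sound (ax x) a = J-bind ⟦ Sequent.succedent (axiom x) ⟧-closed
    (λ {v} _ d → reflect gψ {v} (cut d (substitution (env v) (ax x)))) (reify gφ a)
    where open IsGeometricSequent (axiom-geometric x)
            renaming (antecedent-geometric to gφ; succedent-geometric to gψ)
  sound (identity _) a = a
  sound (cut d e) a = sound e (sound d a)
  sound (substitution {φ = φ} {ψ} σ d) a = push ψ σ (sound d (pull φ σ a))
  sound (⊤-intro _) a = _
  sound (∧-elim₁ _ _) (a , b) = a
  sound (∧-elim₂ _ _) (a , b) = b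
  sound (∧-intro d e) a = sound d a , sound e a
  -- A solved world satisfies `J A` for every `A`.
  sound (⊥-elim {φ = φ} _) a = ⟦ φ ⟧-closed λ f _ → Solved-mono f a
  sound (∨-intro₁ {φ = φ} {ψ} _ _) a = J-unit (⊎-mono φ ψ) (inj₁ a)
  sound (∨-intro₂ {φ = φ} {ψ} _ _) b = J-unit (⊎-mono φ ψ) (inj₂ b)
  sound (∨-elim {χ = χ} d e) = J-bind ⟦ χ ⟧-closed λ _ → Sum.[ sound d , sound e ]
  sound (⋁-intro {φ = φ} _ i) a = J-unit (Σ-mono φ) (i , a)
  sound (⋁-elim {χ = χ} _ d) = J-bind ⟦ χ ⟧-closed λ _ (i , a) → sound (d i) a
  sound (∃-elim {ψ = ψ} d) = J-bind ⟦ ψ ⟧-closed λ _ (t , a) → pull-wk ψ (sound d a)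
  sound (∃-elim⁻¹ {φ = φ} {ψ} d) {w} a = push ψ wkˢ (sound d
    (J-unit (▹Σ-mono φ) (lookup (env w) (here refl) , subst ⟦ φ ⟧ (sym (wk-▹ w)) a)))
  sound (⋁-∧-distrib {φ = φ} {ψ} _ _) (a , b) = J-bind J-closed
    (λ f (i , c) → J-unit (Σ-mono λ i → φ i ∧ ψ) (i , c , ⟦ ψ ⟧-mono f b)) a
  sound (∃-∧-distrib {φ = φ} {ψ} _ _) (a , b) = J-bind J-closed
    (λ f (t , c) → J-unit (▹Σ-mono (φ ∧ weaken ψ)) (t , c , push-wk ψ (⟦ ψ ⟧-mono f b))) a
  sound ≐-refl {w} _ = J-unit (Provable-mono (_ ≐ _)) (⊢≐-refl (assumption-geometric w) _)
  -- Once the equations are provable, `env v` and `ρ [ env v ]ˢ` are provably equal, so monotonicity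
  -- along `relabel` suffices.
  sound (≐-subst {φ = φ} xs ys _) {w} (a , b) = J-bind ⟦ φ [ ρ ] ⟧-closed
    (λ {v} f d → push φ ρ (⟦ φ ⟧-mono (relabel (substituted v d)) (⟦ φ ⟧-mono f b)))
    (reify (≐*-geometric _ _) a)
    where
    ρ = replace xs (vars ys) idˢ

    substituted : ∀ v → Provable (vars (chosen xs) ≐* vars ys) v →
      assumption v ⊢ᵍ env v ≐* ρ [ env v ]ˢ
    substituted v d = subst (λ υ → _ ⊢ᵍ env v ≐* υ)
      (sym (trans (replace-[]ˢ xs (vars ys) idˢ (env v))
        (cong (replace xs (vars ys [ env v ]ˢ)) (id-[]ˢ (env v)))))
      (≐*-replace (assumption-geometric v) xs _ (env v)
        (subst (_ ⊢ᵍ_) (trans (≐*-[] _ _ (env v))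
          (cong (_≐* vars ys [ env v ]ˢ) (vars-tabulate-[]ˢ (Sublist.lookup xs) (env v)))) d))
  sound (⋀-elim _ i) a = a i
  sound (⋀-intro _ d) a i = sound (d i) a
  sound (⇒-intro _ {φ = φ} d) a f b = sound d (⟦ φ ⟧-mono f a , b)
  sound (⇒-intro⁻¹ _ d) (a , b) = sound d a ≤-refl b
  sound (∀-intro _ {φ = φ} d) a f t = sound d (push-wk φ (⟦ φ ⟧-mono f a))
  sound (∀-intro⁻¹ _ {φ = φ} {ψ} d) {w} a = subst ⟦ ψ ⟧ (wk-▹ w)
    (sound d (pull φ wkˢ a) ≤-refl (lookup (env w) (here refl)))
  -- The intuitionistic proof of the double negation of excluded middle, with `Solved` as falsity.
  sound (excluded-middle _) _ f k = k ≤-refl (inj₂ λ g a → k g (inj₁ a))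

  conservative : ∀ {σ} → IsGeometricSequent σ → Derivation classical σ → Derivation geometric σ
  conservative {φ ⊢ ψ} (gφ ⊢ gψ) d =
    reify gψ (sound d {w} (reflect gφ (proj₂ ([]-id gφ)))) ≤-refl λ {v} f e →
      -- The initial environment is `idˢ`, so `env v` is provably equal to `along f`. Hence `e`
      -- yields `ψ [ along f ]`, which entails the goal of `v`.
      cut (transport gψ (env v) (along f)
        (≐*-sym (assumption-geometric v) (along f) (env v)
          (subst (λ υ → _ ⊢ᵍ υ ≐* env v) (id-[]ˢ (along f)) (env≤ f))) e)
        (goal≤ f)
    where
    w : World _
    w = stage gφ gψ , idˢ

-- Inclusions between the three logics.

module _ {ℓ : Level} {T : GeometricTheory ℓ} where

  open GeometricTheory T
  open Deduction T

  -- The logics differ only in the side conditions of their rules. The three arguments translate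
  -- these, which covers both inclusions at once.
  embed : ∀ {L L′} → (∀ {Γ} (φ : Formula Γ) → InLanguage L′ φ) →
    (FirstOrder L → FirstOrder L′) → (L ≡ classical → L′ ≡ classical) →
    ∀ {σ} → Derivation L σ → Derivation L′ σ
  embed {L} {L′} any fo cl = go
    where
    go : ∀ {σ} → Derivation L σ → Derivation L′ σ
    go (ax x)               = ax x
    go (identity _)         = identity (any _)
    go (cut d e)            = cut (go d) (go e)
    go (substitution s d)   = substitution s (go d)
    go (⊤-intro _)          = ⊤-intro (any _)
    go (∧-elim₁ _ _)        = ∧-elim₁ (any _) (any _)
    go (∧-elim₂ _ _)        = ∧-elim₂ (any _) (any _)
    go (∧-intro d e)        = ∧-intro (go d) (go e)
    go (⊥-elim _)           = ⊥-elim (any _)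
    go (∨-intro₁ _ _)       = ∨-intro₁ (any _) (any _)
    go (∨-intro₂ _ _)       = ∨-intro₂ (any _) (any _)
    go (∨-elim d e)         = ∨-elim (go d) (go e)
    go (⋁-intro _ i)        = ⋁-intro (λ _ → any _) i
    go (⋁-elim _ d)         = ⋁-elim (any _) λ i → go (d i)
    go (∃-elim d)           = ∃-elim (go d)
    go (∃-elim⁻¹ d)         = ∃-elim⁻¹ (go d)
    go (⋁-∧-distrib _ _)    = ⋁-∧-distrib (λ _ → any _) (any _)
    go (∃-∧-distrib _ _)    = ∃-∧-distrib (any _) (any _)
    go ≐-refl               = ≐-refl
    go (≐-subst xs ys _)    = ≐-subst xs ys (any _)
    go (⋀-elim l i)         = ⋀-elim (fo l) i
    go (⋀-intro l d)        = ⋀-intro (fo l) λ i → go (d i)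
    go (⇒-intro l d)        = ⇒-intro (fo l) (go d)
    go (⇒-intro⁻¹ l d)      = ⇒-intro⁻¹ (fo l) (go d)
    go (∀-intro l d)        = ∀-intro (fo l) (go d)
    go (∀-intro⁻¹ l d)      = ∀-intro⁻¹ (fo l) (go d)
    go (excluded-middle eq) = excluded-middle (cl eq)

  geometric⇒intuitionistic : ∀ {σ} → Derivation geometric σ → Derivation intuitionistic σ
  geometric⇒intuitionistic = embed (λ _ → _) (λ ()) (λ ())

  intuitionistic⇒classical : ∀ {σ} → Derivation intuitionistic σ → Derivation classical σ
  intuitionistic⇒classical = embed (λ _ → _) (λ _ → classical) (λ ())

theorem11 : ∀ {ℓ : Level} (T : GeometricTheory ℓ) (σ : GeometricTheory.Sequent T) →
    GeometricTheory.IsGeometricSequent T σ →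
    (Deduction.Derivation T geometric σ ⇔ Deduction.Derivation T intuitionistic σ) ×
    (Deduction.Derivation T intuitionistic σ ⇔ Deduction.Derivation T classical σ)
theorem11 T σ g =
    mk⇔ geometric⇒intuitionistic (conservative g ∘ intuitionistic⇒classical)
  , mk⇔ intuitionistic⇒classical (geometric⇒intuitionistic ∘ conservative g)
  where open Semantics T
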